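{- In the ad-hoc radio network model with transmission acknowledgements (defined in the context), there is a deterministic protocol such that, for every acyclic directed graph $G$ with $n$ vertices, labels from $\{0,1,\dots,n-1\}$, and a designated target node $t$ reachable from all other nodes, the protocol completes information gathering on $G$ within $O(n\log^2 n)$ time steps.
   Context: Ad-hoc radio network model: the network is a directed graph $G$ on $n$ nodes, each node having a distinct label from $\{0,1,\dots,n-1\}$; nodes know $n$ and their own label, but the topology of $G$ is unknown to them. Time proceeds in synchronous discrete steps $0,1,2,\dots$, and all nodes start simultaneously at step $0$. In each step each node is either transmitting (sending one message) or receiving. If node $u$ transmits in a step, the message reaches all out-neighbors of $u$; a receiving node $v$ receives a message in that step if and only if exactly one in-neighbor of $v$ transmits in that step; otherwise $v$ receives nothing and cannot distinguish a collision from silence. Messages have unbounded size. Acknowledgements: immediately after each of its transmissions, the transmitting node receives a single bit indicating whether that transmission was successfully received by at least one of its out-neighbors (it learns neither which nor how many). A deterministic protocol specifies each node's transmissions as a function of its label, $n$, the messages it has received, and the acknowledgement bits it has received. Information gathering: each node initially holds a unique rumor; there is a designated target node $t$ reachable by directed paths from all nodes; the task is completed when $t$ holds all $n$ rumors. The running time is the number of steps until completion, in the worst case over all such graphs and labelings. -}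

module Defs where

open import Data.Nat using (ℕ; zero; suc)
open import Data.Bool using (Bool; true; false; if_then_else_; _∧_; _∨_)
open import Data.Fin using (Fin; _≟_)
open import Data.Maybe using (Maybe; just; nothing; is-just)
import Data.Maybe as Maybe
open import Data.List using (List; []; _∷_; mapMaybe; allFin)
open import Data.Bool.ListAction using (any)
open import Data.Product using (_×_; _,_; proj₂)
open import Relation.Nullary using (¬_; does)
open import Relation.Binary.PropositionalEquality using (_≡_)

-- Graphs on the node set Fin n (node = its label).
-- E u v ≡ true  means there is a directed edge u → v.

Graph : ℕ → Set
Graph n = Fin n → Fin n → Bool

data Reach {n : ℕ} (E : Graph n) : Fin n → Fin n → Set where
  here : ∀ {u} → Reach E u u
  step : ∀ {u w v} → E u w ≡ true → Reach E w v → Reach E u v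

Acyclic : ∀ {n} → Graph n → Set
Acyclic {n} E = ∀ (u w : Fin n) → E u w ≡ true → ¬ Reach E w u

-- Local observations of a node in one step:
--   sent b    : the node transmitted and got acknowledgement bit b
--   heard m   : the node listened and received m (nothing = silence/collision)

data Obs (M : Set) : Set where
  sent  : Bool → Obs M
  heard : Maybe M → Obs M

-- A deterministic protocol: for each n a message type and a rule deciding,
-- from n, the node's label and its history of observations (newest first),
-- whether to transmit (just m) or receive (nothing).
record Protocol : Set₁ where
  field
    Msg : ℕ → Set
    act : (n : ℕ) → Fin n → List (Obs (Msg n)) → Maybe (Msg n)

unique : ∀ {A : Set} → List A → Maybe A
unique (x ∷ []) = just x
unique _        = nothing

module _ {M : Set} {n : ℕ} (E : Graph n) (tx : Fin n → Maybe M) where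

  inTx : Fin n → List (Fin n × M)
  inTx v = mapMaybe (λ u → if E u v then Maybe.map (u ,_) (tx u) else nothing) (allFin n)

  -- v (receiving) gets a message iff exactly one in-neighbour transmits;
  -- result records the (hidden) sender and the message
  rcv : Fin n → Maybe (Fin n × M)
  rcv v with tx v
  ... | just _  = nothing
  ... | nothing = unique (inTx v)

  -- acknowledgement for transmitter v: some out-neighbour received (necessarily from v)
  ack : Fin n → Bool
  ack v = any (λ u → E v u ∧ is-just (rcv u)) (allFin n)

  obs : Fin n → Obs M
  obs v with tx v
  ... | just _  = sent (ack v)
  ... | nothing = heard (Maybe.map proj₂ (rcv v))

module _ (P : Protocol) {n : ℕ} (E : Graph n) where
  open Protocol P

  hist : ℕ → Fin n → List (Obs (Msg n))
  hist zero    v = []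
  hist (suc s) v = obs E (λ u → act n u (hist s u)) v ∷ hist s v

  txAt : ℕ → Fin n → Maybe (Msg n)
  txAt s u = act n u (hist s u)

  -- knows s v r : at the start of step s node v holds the rumor of node r.
  -- Messages are of unbounded size, so every received message carries all
  -- rumors known to its sender.
  knows : ℕ → Fin n → Fin n → Bool
  knows zero    v r = does (v ≟ r)
  knows (suc s) v r with rcv E (txAt s) v
  ... | just (u , _) = knows s v r ∨ knows s u r
  ... | nothing      = knows s v r

  Gathered : Fin n → ℕ → Set
  Gathered t T = ∀ (r : Fin n) → knows T t r ≡ true

{-# OPTIONS --safe #-}

-- Every node starts active; an acknowledgement makes it dormant and a reception
-- makes it active again.  Hence each rumor is always held by some active node,
-- and it suffices that all nodes except the sink t eventually stay dormant.
-- Call a node retired when it and all its ancestors are dormant: as only an active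
-- in-neighbour can wake a node, retirement is permanent.  Take the topologically
-- first w that has a non-retired in-neighbour.  Its b non-retired in-neighbours
-- have only retired in-neighbours, so each of them retires at its next
-- acknowledgement.  Active nodes transmit according to interleaved selectors of
-- sizes 2ⁱ; the one with 2ⁱ ≤ b < 2ⁱ⁺¹ retires at least half of the b nodes within
-- O(b log² n) steps, that is, O(log² n) steps per retired node.

module Submission where

open import Defs
open import Data.Nat using (ℕ; zero; suc; _+_; _*_; _∸_; _^_; _/_; _%_; ⌈_/2⌉; ⌊_/2⌋; _≤_; _<_; z≤n; s≤s; _≤?_; _<?_; NonZero; >-nonZero⁻¹)
import Data.Nat as ℕ
open import Data.Nat.Properties hiding (_≟_)
open import Data.Nat.DivMod
open import Data.Nat.Divisibility using (divides-refl)
open import Data.Nat.ListAction using (sum)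
open import Data.Nat.Logarithm using (⌊log₂_⌋; ⌊log₂⌋-mono-≤; ⌊log₂[2^n]⌋≡n)
open import Data.Nat.Tactic.RingSolver using (solve-∀)
open import Data.Bool using (Bool; true; false; _∧_; _∨_; not; if_then_else_)
import Data.Bool as Bool
open import Data.Bool.ListAction using (any; all)
open import Data.Bool.Properties using (∧-comm; ∧-zeroʳ; ∨-zeroʳ; ¬-not)
open import Data.Fin using (Fin; zero; suc; _≟_)
open import Data.Fin.Induction using (spo-wellFounded)
open import Data.Fin.Properties using (any?)
open import Data.List using (List; []; _∷_; _++_; length; map; mapMaybe; filter; take; replicate; allFin; cartesianProduct; cartesianProductWith)
open import Data.List.Properties using (length-map; length-++; length-filter; length-tabulate; length-replicate; length-take)
open import Data.List.Membership.Propositional using (_∈_)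
open import Data.List.Membership.Propositional.Properties using (∈-allFin; ∈-filter⁺; ∈-filter⁻; ∈-++⁺ˡ; ∈-++⁺ʳ; ∈-cartesianProduct⁺; ∈-cartesianProductWith⁺)
import Data.List.Membership.DecPropositional as DecMembership
open import Data.List.Relation.Unary.All as All using (All; []; _∷_)
import Data.List.Relation.Unary.All.Properties as All
open import Data.List.Relation.Unary.AllPairs using ([]; _∷_)
open import Data.List.Relation.Unary.Any using (here; there)
open import Data.List.Relation.Unary.Unique.DecPropositional using (unique?)
open import Data.List.Relation.Unary.Unique.Propositional using (Unique)
import Data.List.Relation.Unary.Unique.Propositional.Properties as Unique
open import Data.Maybe using (Maybe; just; nothing; is-just)
import Data.Maybe as Maybe
open import Data.Product using (Σ; ∃-syntax; _×_; _,_; proj₁; proj₂)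
import Data.Product as Product
open import Data.Sum using (_⊎_; inj₁; inj₂)
open import Data.Unit using (⊤; tt)
open import Data.Vec.Functional using () renaming (_∷_ to _◂_)
open import Algebra.Properties.CommutativeSemigroup *-commutativeSemigroup using (x∙yz≈y∙xz; x∙yz≈yx∙z)
open import Function using (_∘_; id)
open import Induction.WellFounded using (Acc; acc)
open import Relation.Binary.PropositionalEquality using (_≡_; _≢_; refl; sym; trans; cong; cong₂; subst; isEquivalence; resp₂)
open import Relation.Binary.Structures using (IsStrictPartialOrder)
open import Relation.Nullary using (Dec; yes; no; does; contradiction; _×-dec_)
open import Relation.Nullary.Decidable using (map′; dec-true)
open import Relation.Unary using (Decidable)

open ≤-Reasoning

-- Selectors

Transmitters : ℕ → Set
Transmitters n = Fin n → Bool

ind : Bool → ℕ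
ind b = if b then 1 else 0

sum-map-≤ : ∀ {A : Set} {f : A → ℕ} {c} d xs → (∀ x → d * f x ≤ c) →
            d * sum (map f xs) ≤ length xs * c
sum-map-≤ d [] f≤c = ≤-reflexive (*-zeroʳ d)
sum-map-≤ {f = f} {c} d (x ∷ xs) f≤c = begin
  d * (f x + sum (map f xs))      ≡⟨ *-distribˡ-+ d (f x) _ ⟩
  d * f x + d * sum (map f xs)    ≤⟨ +-mono-≤ (f≤c x) (sum-map-≤ d xs f≤c) ⟩
  c + length xs * c               ∎

sum-map-≥ : ∀ {A : Set} {f : A → ℕ} {c} d {xs} → All (λ x → c ≤ d * f x) xs →
            length xs * c ≤ d * sum (map f xs)
sum-map-≥ d [] = z≤n
sum-map-≥ {f = f} {c} d {x ∷ xs} (c≤f ∷ c≤fs) = begin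
  c + length xs * c               ≤⟨ +-mono-≤ c≤f (sum-map-≥ d c≤fs) ⟩
  d * f x + d * sum (map f xs)    ≡⟨ *-distribˡ-+ d (f x) _ ⟨
  d * (f x + sum (map f xs))      ∎

*-chain-≤ : ∀ a b p q {x y z} → p * x ≤ q * y → a * y ≤ b * z → a * p * x ≤ b * q * z
*-chain-≤ a b p q {x} {y} {z} px≤qy ay≤bz = begin
  a * p * x    ≡⟨ *-assoc a p x ⟩
  a * (p * x)  ≤⟨ *-monoʳ-≤ a px≤qy ⟩
  a * (q * y)  ≡⟨ x∙yz≈y∙xz a q y ⟩
  q * (a * y)  ≤⟨ *-monoʳ-≤ q ay≤bz ⟩
  q * (b * z)  ≡⟨ x∙yz≈yx∙z q b z ⟩
  b * q * z    ∎

-- Passes from "at least one part in `1 + d` is hit" to "at most `d` parts in `1 + d` stay unhit",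
-- without division.
fraction-removed : ∀ d u s {l} → u + s ≡ l → l ≤ suc d * s → suc d * u ≤ d * l
fraction-removed d u s {l} u+s≡l l≤s = +-cancelʳ-≤ l _ _ (begin
  suc d * u + l          ≤⟨ +-monoʳ-≤ (suc d * u) l≤s ⟩
  suc d * u + suc d * s  ≡⟨ *-distribˡ-+ (suc d) u s ⟨
  suc d * (u + s)        ≡⟨ cong (suc d *_) u+s≡l ⟩
  suc d * l              ≡⟨ +-comm l (d * l) ⟩
  d * l + l              ∎)

-- Expectations, scaled by (1 + k)ⁿ, over random sets containing each element
-- independently with probability 1 / (1 + k).
module Expectation (k : ℕ) where

  K : ℕ
  K = suc k

  private
    scale : ∀ k p c → k * (p * c) + p * c ≡ (p + k * p) * c
    scale = solve-∀

  𝔼 : ∀ n → (Transmitters n → ℕ) → ℕ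
  𝔼 zero    φ = φ λ ()
  𝔼 (suc n) φ = k * 𝔼 n (φ ∘ (false ◂_)) + 𝔼 n (φ ∘ (true ◂_))

  𝔼-mono : ∀ n {φ ψ : Transmitters n → ℕ} → (∀ f → φ f ≤ ψ f) → 𝔼 n φ ≤ 𝔼 n ψ
  𝔼-mono zero    φ≤ψ = φ≤ψ λ ()
  𝔼-mono (suc n) φ≤ψ =
    +-mono-≤ (*-monoʳ-≤ k (𝔼-mono n (φ≤ψ ∘ (false ◂_)))) (𝔼-mono n (φ≤ψ ∘ (true ◂_)))

  𝔼-const : ∀ n c → 𝔼 n (λ _ → c) ≡ K ^ n * c
  𝔼-const zero    c = sym (*-identityˡ c)
  𝔼-const (suc n) c = trans (cong (λ x → k * x + x) (𝔼-const n c)) (scale k (K ^ n) c)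

  𝔼-+ : ∀ n (φ ψ : Transmitters n → ℕ) → 𝔼 n (λ f → φ f + ψ f) ≡ 𝔼 n φ + 𝔼 n ψ
  𝔼-+ zero    φ ψ = refl
  𝔼-+ (suc n) φ ψ = trans
    (cong₂ (λ x y → k * x + y) (𝔼-+ n (φ ∘ (false ◂_)) _) (𝔼-+ n (φ ∘ (true ◂_)) _))
    (lemma k (𝔼 n (φ ∘ (false ◂_))) _ (𝔼 n (φ ∘ (true ◂_))) _)
    where
    lemma : ∀ k a b c d → k * (a + b) + (c + d) ≡ k * a + c + (k * b + d)
    lemma = solve-∀

  𝔼-sum : ∀ {A : Set} n (φ : A → Transmitters n → ℕ) xs →
          𝔼 n (λ f → sum (map (λ x → φ x f) xs)) ≡ sum (map (λ x → 𝔼 n (φ x)) xs)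
  𝔼-sum n φ []       = trans (𝔼-const n 0) (*-zeroʳ (K ^ n))
  𝔼-sum n φ (x ∷ xs) = trans (𝔼-+ n (φ x) _) (cong (𝔼 n (φ x) +_) (𝔼-sum n φ xs))

  𝔼-single : ∀ {n} (y : Fin n) → K * 𝔼 n (λ f → ind (f y)) ≡ K ^ n
  𝔼-single {suc n} zero = cong (K *_) (trans
    (cong₂ (λ a b → k * a + b) (𝔼-const n 0) (𝔼-const n 1)) (lemma k (K ^ n)))
    where
    lemma : ∀ k p → k * (p * 0) + p * 1 ≡ p
    lemma = solve-∀
  𝔼-single {suc n} (suc y) = cong (K *_) (trans (+-comm (k * _) _) (𝔼-single y))

  𝔼-pair : ∀ {n} {y z : Fin n} → z ≢ y → K * K * 𝔼 n (λ f → ind (f y ∧ f z)) ≤ K ^ n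
  𝔼-pair {y = zero} {zero} z≢y = contradiction refl z≢y
  𝔼-pair {suc n} {zero} {suc z} z≢y = begin
    K * K * (k * 𝔼 n (λ _ → 0) + 𝔼 n (λ f → ind (f z)))
      ≡⟨ cong (λ x → K * K * (k * x + 𝔼 n (λ f → ind (f z)))) (𝔼-const n 0) ⟩
    K * K * (k * (K ^ n * 0) + 𝔼 n (λ f → ind (f z)))
      ≡⟨ lemma k (K ^ n) (𝔼 n (λ f → ind (f z))) ⟩
    K * (K * 𝔼 n (λ f → ind (f z)))
      ≡⟨ cong (K *_) (𝔼-single z) ⟩
    K * K ^ n ∎
    where
    lemma : ∀ k p e → suc k * suc k * (k * (p * 0) + e) ≡ suc k * (suc k * e)
    lemma = solve-∀
  𝔼-pair {suc n} {suc y} {zero} z≢y = ≤-trans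
    (*-monoʳ-≤ (K * K) (𝔼-mono (suc n) {ψ = λ f → ind (f zero ∧ f (suc y))}
      λ f → ≤-reflexive (cong ind (∧-comm (f (suc y)) _))))
    (𝔼-pair {suc n} {zero} {suc y} (z≢y ∘ sym))
  𝔼-pair {suc n} {suc y} {suc z} z≢y = begin
    K * K * (k * e + e)  ≡⟨ lemma k e ⟩
    K * (K * K * e)      ≤⟨ *-monoʳ-≤ K (𝔼-pair (z≢y ∘ cong suc)) ⟩
    K * K ^ n            ∎
    where
    e = 𝔼 n (λ f → ind (f y ∧ f z))
    lemma : ∀ k e → suc k * suc k * (k * e + e) ≡ suc k * (suc k * suc k * e)
    lemma = solve-∀

  -- The probabilistic method made constructive: fixing membership one element at a time and keeping
  -- the better branch never falls below the mean.
  𝔼-attained : ∀ n (φ : Transmitters n → ℕ) → ∃[ f ] 𝔼 n φ ≤ K ^ n * φ f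
  𝔼-attained zero φ = (λ ()) , ≤-reflexive (sym (*-identityˡ _))
  𝔼-attained (suc n) φ with 𝔼-attained n (φ ∘ (false ◂_)) | 𝔼-attained n (φ ∘ (true ◂_))
  ... | f , f-bound | g , g-bound with ≤-total (φ (false ◂ f)) (φ (true ◂ g))
  ... | inj₁ f≤g = true ◂ g , (begin
    k * 𝔼 n (φ ∘ (false ◂_)) + 𝔼 n (φ ∘ (true ◂_))
      ≤⟨ +-mono-≤ (*-monoʳ-≤ k (≤-trans f-bound (*-monoʳ-≤ (K ^ n) f≤g))) g-bound ⟩
    k * (K ^ n * φ (true ◂ g)) + K ^ n * φ (true ◂ g)
      ≡⟨ scale k (K ^ n) (φ (true ◂ g)) ⟩
    K ^ suc n * φ (true ◂ g) ∎)
  ... | inj₂ g≤f = false ◂ f , (begin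
    k * 𝔼 n (φ ∘ (false ◂_)) + 𝔼 n (φ ∘ (true ◂_))
      ≤⟨ +-mono-≤ (*-monoʳ-≤ k f-bound) (≤-trans g-bound (*-monoʳ-≤ (K ^ n) g≤f)) ⟩
    k * (K ^ n * φ (false ◂ f)) + K ^ n * φ (false ◂ f)
      ≡⟨ scale k (K ^ n) (φ (false ◂ f)) ⟩
    K ^ suc n * φ (false ◂ f) ∎)

any-witness : ∀ {A : Set} (p : A → Bool) xs → any p xs ≡ true → ∃[ x ] x ∈ xs × p x ≡ true
any-witness p (x ∷ xs) eq with p x in px
... | true  = x , here refl , px
... | false with any-witness p xs eq
...   | y , y∈xs , py = y , there y∈xs , py

-- Isolation by random sets and greedy covering of configurations

module _ {n : ℕ} where

  -- The disjunct `does (z ≟ y)` lets `y` itself occur in `W`, even repeatedly.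
  isolates : Transmitters n → List (Fin n) → Fin n → Bool
  isolates f W y = f y ∧ all (λ z → does (z ≟ y) ∨ not (f z)) W

  clash : Fin n → Fin n → Transmitters n → ℕ
  clash y z f = if does (z ≟ y) then 0 else ind (f y ∧ f z)

  -- Bonferroni: only pairwise independence of the random set is needed.
  isolates-bound : ∀ f W y → ind (f y) ≤ ind (isolates f W y) + sum (map (λ z → clash y z f) W)
  isolates-bound f W y with f y
  ... | false = z≤n
  ... | true  = go W
    where
    go : ∀ W → 1 ≤ ind (all (λ z → does (z ≟ y) ∨ not (f z)) W) +
                   sum (map (λ z → if does (z ≟ y) then 0 else ind (f z)) W)
    go [] = ≤-refl
    go (z ∷ W) with does (z ≟ y) | f z
    ... | true  | _     = go W
    ... | false | true  = m≤m+n 1 _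
    ... | false | false = go W

  isolates-sound : ∀ f W y → isolates f W y ≡ true →
                   f y ≡ true × (∀ {z} → z ∈ W → z ≢ y → f z ≡ false)
  isolates-sound f W y iso with f y
  ... | true = refl , go W iso
    where
    go : ∀ W → all (λ z → does (z ≟ y) ∨ not (f z)) W ≡ true → ∀ {z} → z ∈ W → z ≢ y → f z ≡ false
    go (x ∷ W) iso z∈W z≢y with x ≟ y | f x in fx
    go (x ∷ W) iso (here refl)  z≢y | yes z≡y | _     = contradiction z≡y z≢y
    go (x ∷ W) iso (there z∈W) z≢y | yes _   | _     = go W iso z∈W z≢y
    go (x ∷ W) iso (here refl)  z≢y | no _    | false = fx
    go (x ∷ W) iso (there z∈W) z≢y | no _    | false = go W iso z∈W z≢y

  none-isolated : ∀ f W y Y → isolates f W y ≡ true → All (y ≢_) Y → All (_∈ W) Y →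
                  sum (map (λ z → ind (isolates f W z)) Y) ≡ 0
  none-isolated f W y [] iso [] [] = refl
  none-isolated f W y (z ∷ Y) iso (y≢z ∷ y≢Y) (z∈W ∷ Y⊆W)
    rewrite proj₂ (isolates-sound f W y iso) z∈W (y≢z ∘ sym) = none-isolated f W y Y iso y≢Y Y⊆W

  -- Since `Y` lies in `W`, isolating one node silences the others. The isolation events are
  -- therefore disjoint, and their probabilities add up to at most that of a hit.
  at-most-one-isolated : ∀ f W {Y} → Unique Y → All (_∈ W) Y →
    sum (map (λ y → ind (isolates f W y)) Y) ≤ ind (any (isolates f W) Y)
  at-most-one-isolated f W [] [] = z≤n
  at-most-one-isolated f W {y ∷ Y} (y∉Y ∷ uniq) (y∈W ∷ Y⊆W) with isolates f W y in iso
  ... | true  = ≤-reflexive (cong suc (none-isolated f W y Y iso y∉Y Y⊆W))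
  ... | false = at-most-one-isolated f W uniq Y⊆W

  -- In (Y , W) the nodes of W compete, and one of those in Y ⊆ W is to be isolated.
  Configuration : Set
  Configuration = List (Fin n) × List (Fin n)

  -- Exact lengths make the configurations easy to enumerate. Only `Y` has to be duplicate-free:
  -- shorter lists of competitors are padded to length `2 * h` by repetition.
  record Valid (h : ℕ) (c : Configuration) : Set where
    constructor valid
    field
      distinct : Unique (proj₁ c)
      subset   : All (_∈ proj₂ c) (proj₁ c)
      half     : length (proj₁ c) ≡ ⌈ h /2⌉
      double   : length (proj₂ c) ≡ 2 * h

  hits : Transmitters n → Configuration → Bool
  hits f (Y , W) = any (isolates f W) Y

  hitCount : Transmitters n → List Configuration → ℕ
  hitCount f cs = sum (map (λ c → ind (hits f c)) cs)

  unhit : Transmitters n → List Configuration → List Configuration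
  unhit f = filter (λ c → hits f c Bool.≟ false)

  unhit-length : ∀ f cs → length (unhit f cs) + hitCount f cs ≡ length cs
  unhit-length f [] = refl
  unhit-length f (c ∷ cs) with hits f c
  ... | true  = trans (+-suc _ _) (cong suc (unhit-length f cs))
  ... | false = cong suc (unhit-length f cs)

  -- Each round takes a good set for the configurations that no earlier round has hit, so the number
  -- left shrinks by the factor `b / a` per round.
  greedy : ∀ h a b → (∀ cs → All (Valid h) cs → ∃[ f ] a * length (unhit f cs) ≤ b * length cs) →
    ∀ R cs → All (Valid h) cs →
    Σ (ℕ → Transmitters n) λ F → ∃[ left ] a ^ R * length left ≤ b ^ R * length cs ×
      (∀ {c} → c ∈ cs → (∃[ q ] q < R × hits (F q) c ≡ true) ⊎ c ∈ left)
  greedy h a b good-step zero    cs cs-valid = (λ _ _ → false) , cs , ≤-refl , inj₂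
  greedy h a b good-step (suc R) cs cs-valid
    with f , good ← good-step cs cs-valid
    with F , left , bound , covers ← greedy h a b good-step R (unhit f cs)
      (All.filter⁺ (λ c → hits f c Bool.≟ false) cs-valid)
    = F′ , left , *-chain-≤ a b (a ^ R) (b ^ R) bound good , covers′
    where
    F′ : ℕ → Transmitters n
    F′ zero    = f
    F′ (suc q) = F q

    covers′ : ∀ {c} → c ∈ cs → (∃[ q ] q < suc R × hits (F′ q) c ≡ true) ⊎ c ∈ left
    covers′ {c} c∈cs with hits f c in hit
    ... | true  = inj₁ (0 , s≤s z≤n , hit)
    ... | false with covers (∈-filter⁺ (λ c → hits f c Bool.≟ false) c∈cs hit)
    ...   | inj₁ (q , q<R , hit′) = inj₁ (suc q , s≤s q<R , hit′)
    ...   | inj₂ c∈left           = inj₂ c∈left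

  module _ (k h : ℕ) .{{_ : NonZero h}} (K≡4h : suc k ≡ 4 * h) where

    open Expectation k

    -- With transmission probability `1 / K`, the node `y` transmits with probability `1 / K`, and
    -- each of the `2 * h` competitors spoils this with probability at most `1 / K²`. As `K` is
    -- `4 * h`, at least half of `1 / K` survives, that is `2 * h / K²`.
    isolation-probability : ∀ W y → length W ≡ 2 * h →
                            2 * h * K ^ n ≤ K * K * 𝔼 n (λ f → ind (isolates f W y))
    isolation-probability W y |W| = +-cancelʳ-≤ (2 * h * K ^ n) _ _ (begin
      2 * h * K ^ n + 2 * h * K ^ n
        ≡⟨ double h (K ^ n) ⟩
      4 * h * K ^ n
        ≡⟨ cong (_* K ^ n) K≡4h ⟨
      K * K ^ n
        ≡⟨ cong (K *_) (𝔼-single y) ⟨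
      K * (K * 𝔼 n (λ f → ind (f y)))
        ≡⟨ *-assoc K K _ ⟨
      K * K * 𝔼 n (λ f → ind (f y))
        ≤⟨ *-monoʳ-≤ (K * K) (𝔼-mono n (λ f → isolates-bound f W y)) ⟩
      K * K * 𝔼 n (λ f → ind (isolates f W y) + sum (map (λ z → clash y z f) W))
        ≡⟨ cong (K * K *_) (trans (𝔼-+ n (λ f → ind (isolates f W y)) _)
             (cong (𝔼 n (λ f → ind (isolates f W y)) +_) (𝔼-sum n (clash y) W))) ⟩
      K * K * (𝔼 n (λ f → ind (isolates f W y)) + sum (map (λ z → 𝔼 n (clash y z)) W))
        ≡⟨ *-distribˡ-+ (K * K) (𝔼 n (λ f → ind (isolates f W y))) _ ⟩
      K * K * 𝔼 n (λ f → ind (isolates f W y)) + K * K * sum (map (λ z → 𝔼 n (clash y z)) W)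
        ≤⟨ +-monoʳ-≤ (K * K * 𝔼 n (λ f → ind (isolates f W y))) (sum-map-≤ (K * K) W clash-bound) ⟩
      K * K * 𝔼 n (λ f → ind (isolates f W y)) + length W * K ^ n
        ≡⟨ cong (λ l → K * K * 𝔼 n (λ f → ind (isolates f W y)) + l * K ^ n) |W| ⟩
      K * K * 𝔼 n (λ f → ind (isolates f W y)) + 2 * h * K ^ n ∎)
      where
      double : ∀ h p → 2 * h * p + 2 * h * p ≡ 4 * h * p
      double = solve-∀
      clash-bound : ∀ z → K * K * 𝔼 n (clash y z) ≤ K ^ n
      clash-bound z with z ≟ y
      ... | yes _  = subst (_≤ K ^ n) (sym (trans
        (cong (K * K *_) (trans (𝔼-const n 0) (*-zeroʳ (K ^ n)))) (*-zeroʳ (K * K)))) z≤n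
      ... | no z≢y = 𝔼-pair z≢y

    -- Disjoint events for at least `h / 2` nodes, each of probability at least `2 * h / (4 * h)²`,
    -- add up to at least `1 / 16`. Both sides are multiplied by `h * h` to clear denominators.
    hitting-probability : ∀ c → Valid h c → K ^ n ≤ 16 * 𝔼 n (λ f → ind (hits f c))
    hitting-probability (Y , W) (valid uniq Y⊆W |Y| |W|) = *-cancelˡ-≤ (h * h) {{m*n≢0 h h}} (begin
      h * h * K ^ n
        ≤⟨ *-monoˡ-≤ (K ^ n) (*-monoˡ-≤ h h≤2⌈h/2⌉) ⟩
      ⌈ h /2⌉ * 2 * h * K ^ n
        ≡⟨ regroup ⌈ h /2⌉ h (K ^ n) ⟩
      ⌈ h /2⌉ * (2 * h * K ^ n)
        ≡⟨ cong (_* (2 * h * K ^ n)) |Y| ⟨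
      length Y * (2 * h * K ^ n)
        ≤⟨ sum-map-≥ (K * K) (All.universal (λ y → isolation-probability W y |W|) Y) ⟩
      K * K * sum (map (λ y → 𝔼 n (λ f → ind (isolates f W y))) Y)
        ≡⟨ cong (K * K *_) (𝔼-sum n (λ y f → ind (isolates f W y)) Y) ⟨
      K * K * 𝔼 n (λ f → sum (map (λ y → ind (isolates f W y)) Y))
        ≤⟨ *-monoʳ-≤ (K * K) (𝔼-mono n (λ f → at-most-one-isolated f W uniq Y⊆W)) ⟩
      K * K * 𝔼 n (λ f → ind (any (isolates f W) Y))
        ≡⟨ cong (λ K → K * K * 𝔼 n (λ f → ind (any (isolates f W) Y))) K≡4h ⟩
      4 * h * (4 * h) * 𝔼 n (λ f → ind (any (isolates f W) Y))
        ≡⟨ square h _ ⟩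
      h * h * (16 * 𝔼 n (λ f → ind (any (isolates f W) Y))) ∎)
      where
      regroup : ∀ m h p → m * 2 * h * p ≡ m * (2 * h * p)
      regroup = solve-∀
      square : ∀ h e → 4 * h * (4 * h) * e ≡ h * h * (16 * e)
      square = solve-∀
      h≤2⌈h/2⌉ : h ≤ ⌈ h /2⌉ * 2
      h≤2⌈h/2⌉ = begin
        h                     ≡⟨ ⌊n/2⌋+⌈n/2⌉≡n h ⟨
        ⌊ h /2⌋ + ⌈ h /2⌉     ≤⟨ +-monoˡ-≤ ⌈ h /2⌉ (⌊n/2⌋≤⌈n/2⌉ h) ⟩
        ⌈ h /2⌉ + ⌈ h /2⌉     ≡⟨ twice ⌈ h /2⌉ ⟩
        ⌈ h /2⌉ * 2           ∎
        where
        twice : ∀ m → m + m ≡ m * 2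
        twice = solve-∀

    -- By linearity the expected number of hits is a sixteenth of all configurations or more, and
    -- some set does as well as the mean.
    frequent-set : ∀ cs → All (Valid h) cs → ∃[ f ] length cs ≤ 16 * hitCount f cs
    frequent-set cs cs-valid with 𝔼-attained n (λ f → hitCount f cs)
    ... | f , attained = f , *-cancelˡ-≤ (K ^ n) {{m^n≢0 K n}} (begin
      K ^ n * length cs
        ≡⟨ *-comm (K ^ n) _ ⟩
      length cs * K ^ n
        ≤⟨ sum-map-≥ 16 (All.map (λ {c} → hitting-probability c) cs-valid) ⟩
      16 * sum (map (λ c → 𝔼 n (λ f → ind (hits f c))) cs)
        ≡⟨ cong (16 *_) (𝔼-sum n (λ c f → ind (hits f c)) cs) ⟨
      16 * 𝔼 n (λ f → hitCount f cs)
        ≤⟨ *-monoʳ-≤ 16 attained ⟩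
      16 * (K ^ n * hitCount f cs)
        ≡⟨ swap (K ^ n) _ ⟩
      K ^ n * (16 * hitCount f cs) ∎)
      where
      swap : ∀ a b → 16 * (a * b) ≡ a * (16 * b)
      swap = solve-∀

    good-set : ∀ cs → All (Valid h) cs → ∃[ f ] 16 * length (unhit f cs) ≤ 15 * length cs
    good-set cs cs-valid = Product.map₂
      (λ {f} → fraction-removed 15 (length (unhit f cs)) (hitCount f cs) {length cs} (unhit-length f cs))
      (frequent-set cs cs-valid)

-- Enumeration of configurations

length-cartesianProductWith : ∀ {A B C : Set} (f : A → B → C) xs ys →
  length (cartesianProductWith f xs ys) ≡ length xs * length ys
length-cartesianProductWith f []       ys = refl
length-cartesianProductWith f (x ∷ xs) ys = trans (length-++ (map (f x) ys))
  (cong₂ _+_ (length-map (f x) ys) (length-cartesianProductWith f xs ys))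

listsOf : ∀ n → ℕ → List (List (Fin n))
listsOf n zero    = [] ∷ []
listsOf n (suc m) = cartesianProductWith _∷_ (allFin n) (listsOf n m)

length-listsOf : ∀ n m → length (listsOf n m) ≡ n ^ m
length-listsOf n zero    = refl
length-listsOf n (suc m) = trans (length-cartesianProductWith _∷_ (allFin n) (listsOf n m))
  (cong₂ _*_ (length-tabulate {n = n} (λ i → i)) (length-listsOf n m))

∈-listsOf : ∀ {n} (xs : List (Fin n)) → xs ∈ listsOf n (length xs)
∈-listsOf []       = here refl
∈-listsOf (x ∷ xs) = ∈-cartesianProductWith⁺ _∷_ (∈-allFin x) (∈-listsOf xs)

valid? : ∀ {n} h → Decidable (Valid {n} h)
valid? {n} h (Y , W) = map′ (λ (u , s , l , d) → valid u s l d) (λ (valid u s l d) → u , s , l , d)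
  (unique? _≟_ Y ×-dec All.all? (_∈? W) Y ×-dec length Y ℕ.≟ ⌈ h /2⌉ ×-dec length W ℕ.≟ 2 * h)
  where open DecMembership (_≟_ {n}) using (_∈?_)

configurations : ∀ n h → List (Configuration {n})
configurations n h = filter (valid? h) (cartesianProduct (listsOf n ⌈ h /2⌉) (listsOf n (2 * h)))

∈-configurations : ∀ {n} h {c} → Valid {n} h c → c ∈ configurations n h
∈-configurations {n} h {Y , W} v@(valid _ _ |Y| |W|) = ∈-filter⁺ (valid? h)
  (∈-cartesianProduct⁺ (subst (λ m → Y ∈ listsOf n m) |Y| (∈-listsOf Y))
                       (subst (λ m → W ∈ listsOf n m) |W| (∈-listsOf W))) v

-- A configuration consists of at most `3 * h` labels of `L` bits each.
length-configurations : ∀ n h L → n ≤ 2 ^ L → length (configurations n h) ≤ 2 ^ (L * (3 * h))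
length-configurations n h L n≤2^L = begin
  length (configurations n h)
    ≤⟨ length-filter (valid? h) (cartesianProduct (listsOf n ⌈ h /2⌉) (listsOf n (2 * h))) ⟩
  length (cartesianProduct (listsOf n ⌈ h /2⌉) (listsOf n (2 * h)))
    ≡⟨ length-cartesianProductWith _,_ (listsOf n ⌈ h /2⌉) (listsOf n (2 * h)) ⟩
  length (listsOf n ⌈ h /2⌉) * length (listsOf n (2 * h))
    ≡⟨ cong₂ _*_ (length-listsOf n ⌈ h /2⌉) (length-listsOf n (2 * h)) ⟩
  n ^ ⌈ h /2⌉ * n ^ (2 * h)
    ≡⟨ ^-distribˡ-+-* n ⌈ h /2⌉ (2 * h) ⟨
  n ^ (⌈ h /2⌉ + 2 * h)
    ≤⟨ ^-monoˡ-≤ (⌈ h /2⌉ + 2 * h) n≤2^L ⟩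
  (2 ^ L) ^ (⌈ h /2⌉ + 2 * h)
    ≤⟨ ^-monoʳ-≤ (2 ^ L) {{m^n≢0 2 L}} (+-monoˡ-≤ (2 * h) (⌈n/2⌉≤n h)) ⟩
  (2 ^ L) ^ (3 * h)
    ≡⟨ ^-*-assoc 2 L (3 * h) ⟩
  2 ^ (L * (3 * h)) ∎

-- Selectors from greedy covering

^-distribʳ-* : ∀ e a b → (a * b) ^ e ≡ a ^ e * b ^ e
^-distribʳ-* zero    a b = refl
^-distribʳ-* (suc e) a b = trans (cong (a * b *_) (^-distribʳ-* e a b)) ([m*n]*[o*p]≡[m*o]*[n*p] a b (a ^ e) (b ^ e))

-- If `r` rounds halve the count, `r * e` rounds bring fewer than `2 ^ e` items below one, hence to
-- none.
geometric-exhausts : ∀ a b r .{{_ : NonZero a}} .{{_ : NonZero b}} → a ^ r * 2 ≤ b ^ r →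
  ∀ e x left → x < 2 ^ e → b ^ (r * e) * left ≤ a ^ (r * e) * x → left ≡ 0
geometric-exhausts a b r halves e x zero         _     _     = refl
geometric-exhausts a b r halves e x left@(suc _) x<2^e bound = contradiction (begin-strict
  a ^ (r * e) * x       <⟨ *-monoʳ-< (a ^ (r * e)) {{m^n≢0 a (r * e)}} x<2^e ⟩
  a ^ (r * e) * 2 ^ e   ≡⟨ cong (_* 2 ^ e) (^-*-assoc a r e) ⟨
  (a ^ r) ^ e * 2 ^ e   ≡⟨ ^-distribʳ-* e (a ^ r) 2 ⟨
  (a ^ r * 2) ^ e       ≤⟨ ^-monoˡ-≤ e halves ⟩
  (b ^ r) ^ e           ≡⟨ ^-*-assoc b r e ⟩
  b ^ (r * e)           ≤⟨ m≤m*n (b ^ (r * e)) left ⟩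
  b ^ (r * e) * left    ≤⟨ bound ⟩
  a ^ (r * e) * x       ∎) (<-irrefl refl)

-- Eleven is the least exponent that brings the power of `15 / 16` down to one half.
eleven-rounds-halve : 15 ^ 11 * 2 ≤ 16 ^ 11
eleven-rounds-halve = ≤ᵇ⇒≤ (15 ^ 11 * 2) (16 ^ 11) _

-- A relative of the (k,m,n)-selectors: rather than isolating every node of `W`, the family leaves
-- fewer than `⌈ h /2⌉` of them never isolated. This weakening allows a size linear in `h` up to a
-- logarithm.
record Selector (n h R : ℕ) : Set where
  field
    family : ℕ → Transmitters n
    selects : ∀ {Y W} → Valid h (Y , W) →
      ∃[ q ] q < R × ∃[ y ] y ∈ Y × family q y ≡ true × (∀ {z} → z ∈ W → z ≢ y → family q z ≡ false)

greedy-selector : ∀ n h L a b r .{{_ : NonZero h}} .{{_ : NonZero L}} .{{_ : NonZero a}} .{{_ : NonZero b}} →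
  n ≤ 2 ^ L → b ^ r * 2 ≤ a ^ r →
  (∀ cs → All (Valid {n} h) cs → ∃[ f ] a * length (unhit f cs) ≤ b * length cs) →
  Selector n h (r * (L * (4 * h)))
greedy-selector n h L a b r n≤2^L halves good-step
  with F , left , bound , covers ← greedy h a b good-step (r * (L * (4 * h))) (configurations n h)
    (All.all-filter (valid? h) (cartesianProduct (listsOf n ⌈ h /2⌉) (listsOf n (2 * h))))
  = record { family = F ; selects = selects }
  where
  left≡0 : length left ≡ 0
  left≡0 = geometric-exhausts b a r halves (L * (4 * h)) (length (configurations n h)) (length left)
    (≤-<-trans (length-configurations n h L n≤2^L)
      -- Taking `4 * h` in place of the `3 * h` from the count makes the inequality strict.
      (^-monoʳ-< 2 (s≤s (s≤s z≤n)) (*-monoʳ-< L (*-monoˡ-< h {3} {4} ≤-refl))))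
    bound

  selects : ∀ {Y W} → Valid h (Y , W) →
    ∃[ q ] q < r * (L * (4 * h)) × ∃[ y ] y ∈ Y × F q y ≡ true × (∀ {z} → z ∈ W → z ≢ y → F q z ≡ false)
  selects {Y} {W} v with covers (∈-configurations h v)
  ... | inj₂ c∈left = contradiction left≡0 (nonempty c∈left)
    where
    nonempty : ∀ {c : Configuration {n}} {cs} → c ∈ cs → length cs ≢ 0
    nonempty (here _)  ()
    nonempty (there _) ()
  ... | inj₁ (q , q<R , hit) with any-witness (isolates (F q) W) Y hit
  ...   | y , y∈Y , iso = q , q<R , y , y∈Y , isolates-sound (F q) W y iso

selector : ∀ n h L .{{_ : NonZero h}} .{{_ : NonZero L}} → n ≤ 2 ^ L → Selector n h (11 * (L * (4 * h)))
-- With `h` a successor, `4 * h` reduces to one too, so `refl` determines `k` in `suc k ≡ 4 * h`.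
selector n h@(suc _) L n≤2^L = greedy-selector n h L 16 15 11 n≤2^L eleven-rounds-halve (good-set _ h refl)

-- Reception

any-true : ∀ {A : Set} (p : A → Bool) {x xs} → x ∈ xs → p x ≡ true → any p xs ≡ true
any-true p (here refl) px rewrite px = refl
any-true p {xs = y ∷ xs} (there x∈xs) px rewrite any-true p x∈xs px = ∨-zeroʳ (p y)

module _ {A B : Set} (g : A → Maybe B) where

  ∈-mapMaybe⁺ : ∀ {x y xs} → x ∈ xs → g x ≡ just y → y ∈ mapMaybe g xs
  ∈-mapMaybe⁺ (here refl) gx rewrite gx = here refl
  ∈-mapMaybe⁺ {xs = z ∷ xs} (there x∈xs) gx with g z
  ... | just _  = there (∈-mapMaybe⁺ x∈xs gx)
  ... | nothing = ∈-mapMaybe⁺ x∈xs gx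

  ∈-mapMaybe⁻ : ∀ {y} xs → y ∈ mapMaybe g xs → ∃[ x ] g x ≡ just y
  ∈-mapMaybe⁻ (x ∷ xs) y∈ with g x in gx | y∈
  ... | just _  | here refl  = x , gx
  ... | just _  | there y∈xs = ∈-mapMaybe⁻ xs y∈xs
  ... | nothing | y∈xs       = ∈-mapMaybe⁻ xs y∈xs

  mapMaybe-nothing : ∀ {xs} → All (λ x → g x ≡ nothing) xs → mapMaybe g xs ≡ []
  mapMaybe-nothing [] = refl
  mapMaybe-nothing (gx ∷ gxs) rewrite gx = mapMaybe-nothing gxs

  mapMaybe-singleton : ∀ {x y xs} → Unique xs → x ∈ xs → g x ≡ just y →
                       (∀ z → z ≢ x → g z ≡ nothing) → mapMaybe g xs ≡ y ∷ []
  mapMaybe-singleton (x∉xs ∷ _) (here refl) gx others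
    rewrite gx = cong (_ ∷_) (mapMaybe-nothing (All.map (λ x≢z → others _ (x≢z ∘ sym)) x∉xs))
  mapMaybe-singleton {x} (z∉xs ∷ uniq) (there x∈xs) gx others
    rewrite others _ (All.lookup z∉xs x∈xs) = mapMaybe-singleton uniq x∈xs gx others

unique-just : ∀ {A : Set} {x : A} xs → unique xs ≡ just x → xs ≡ x ∷ []
unique-just (x ∷ []) refl = refl

module _ {M : Set} {n : ℕ} (E : Graph n) (tx : Fin n → Maybe M) where

  incoming : Fin n → Fin n → Maybe (Fin n × M)
  incoming v u = if E u v then Maybe.map (u ,_) (tx u) else nothing

  incoming-just : ∀ {v u p} → incoming v u ≡ just p → E u v ≡ true × proj₁ p ≡ u × tx u ≡ just (proj₂ p)
  incoming-just {v} {u} eq with E u v | tx u | eq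
  ... | true | just m | refl = refl , refl , refl

  rcv-just : ∀ {v p} → rcv E tx v ≡ just p → tx v ≡ nothing × inTx E tx v ≡ p ∷ []
  rcv-just {v} eq with tx v
  ... | nothing = refl , unique-just _ eq

  rcv-listening : ∀ {v} → tx v ≡ nothing → rcv E tx v ≡ unique (inTx E tx v)
  rcv-listening {v} eq with tx v
  ... | nothing = refl

  rcv-sender : ∀ {v u m} → rcv E tx v ≡ just (u , m) → E u v ≡ true × tx u ≡ just m
  rcv-sender {v} {u} {m} eq
    with x , inc ← ∈-mapMaybe⁻ (incoming v) (allFin n)
           (subst ((u , m) ∈_) (sym (proj₂ (rcv-just eq))) (here refl))
    with E-xv , refl , tx-x ← incoming-just inc = E-xv , tx-x

  -- The acknowledging out-neighbour has a single incoming message, and the one from `v` is among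
  -- its incoming messages, so it received exactly that one.
  ack-receiver : ∀ {v m} → tx v ≡ just m → ack E tx v ≡ true → ∃[ u ] rcv E tx u ≡ just (v , m)
  ack-receiver {v} {m} tx-v acked with any-witness _ (allFin n) acked
  ... | u , _ , got with E v u in E-vu | rcv E tx u in rcv-u | got
  ...   | true | just p | _ with subst ((v , m) ∈_) (proj₂ (rcv-just rcv-u)) (∈-mapMaybe⁺ (incoming u) (∈-allFin v) inc)
    where
    inc : incoming u v ≡ just (v , m)
    inc rewrite E-vu | tx-v = refl
  ...     | here refl = u , rcv-u

  sole-transmitter-acked : ∀ {y w m} → E y w ≡ true → tx y ≡ just m → tx w ≡ nothing →
    (∀ z → E z w ≡ true → z ≢ y → tx z ≡ nothing) → ack E tx y ≡ true
  sole-transmitter-acked {y} {w} {m} E-yw tx-y tx-w others = any-true _ (∈-allFin w) received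
    where
    inc : incoming w y ≡ just (y , m)
    inc rewrite E-yw | tx-y = refl

    silent : ∀ z → z ≢ y → incoming w z ≡ nothing
    silent z z≢y with E z w in E-zw
    ... | false = refl
    ... | true rewrite others z E-zw z≢y = refl

    received : (E y w ∧ is-just (rcv E tx w)) ≡ true
    received rewrite E-yw | rcv-listening tx-w
      | mapMaybe-singleton (incoming w) (Unique.allFin⁺ n) (∈-allFin y) inc silent = refl

  obs-sent : ∀ {v m} → tx v ≡ just m → obs E tx v ≡ sent (ack E tx v)
  obs-sent {v} eq with tx v
  ... | just _ = refl

  obs-heard : ∀ {v} → tx v ≡ nothing → obs E tx v ≡ heard (Maybe.map proj₂ (rcv E tx v))
  obs-heard {v} eq with tx v in tx-v
  ... | nothing = cong (heard ∘ Maybe.map proj₂) (rcv-listening tx-v)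

-- The relay protocol

active : List (Obs ⊤) → Bool
active []                       = true
active (sent true         ∷ os) = false
active (sent false        ∷ os) = active os
active (heard (just _)    ∷ os) = true
active (heard nothing     ∷ os) = active os

active-heard : ∀ r {os} → active os ≡ true → active (heard r ∷ os) ≡ true
active-heard (just _) act = refl
active-heard nothing  act = act

active-sent : ∀ b {os} → active os ≡ true → active (sent b ∷ os) ≡ false → b ≡ true
active-sent true  act retired = refl
active-sent false act retired = contradiction (trans (sym act) retired) λ ()

module Relay (schedule : ∀ n → ℕ → Transmitters n) where

  -- Messages need no content because `knows` already passes on all rumors of the sender. One
  -- observation is recorded per step, so `length os` is the current time.
  protocol : Protocol
  protocol = record
    { Msg = λ _ → ⊤
    ; act = λ n v os → if active os ∧ schedule n (length os) v then just tt else nothing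
    }

  module Run {n : ℕ} (E : Graph n) where

    Active : ℕ → Fin n → Bool
    Active s v = active (hist protocol E s v)

    tx : ℕ → Fin n → Maybe ⊤
    tx = txAt protocol E

    length-hist : ∀ s v → length (hist protocol E s v) ≡ s
    length-hist zero    v = refl
    length-hist (suc s) v = cong suc (length-hist s v)

    tx-rule : ∀ s v → tx s v ≡ (if Active s v ∧ schedule n s v then just tt else nothing)
    tx-rule s v = cong (λ l → if Active s v ∧ schedule n l v then just tt else nothing) (length-hist s v)

    tx-just : ∀ {s v} → Active s v ≡ true → schedule n s v ≡ true → tx s v ≡ just tt
    tx-just {s} {v} act sch rewrite tx-rule s v | act | sch = refl

    tx-nothing : ∀ {s v} → (Active s v ∧ schedule n s v) ≡ false → tx s v ≡ nothing
    tx-nothing {s} {v} eq rewrite tx-rule s v | eq = refl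

    tx-active : ∀ {s v m} → tx s v ≡ just m → Active s v ≡ true
    tx-active {s} {v} eq with Active s v | trans (sym (tx-rule s v)) eq
    ... | true | _ = refl

    active-after-listening : ∀ {s v} → tx s v ≡ nothing →
      Active (suc s) v ≡ active (heard (Maybe.map proj₂ (rcv E (tx s) v)) ∷ hist protocol E s v)
    active-after-listening {s} {v} tx-v = cong (λ o → active (o ∷ hist protocol E s v)) (obs-heard E (tx s) tx-v)

    active-after-sending : ∀ {s v m} → tx s v ≡ just m →
      Active (suc s) v ≡ active (sent (ack E (tx s) v) ∷ hist protocol E s v)
    active-after-sending {s} {v} tx-v = cong (λ o → active (o ∷ hist protocol E s v)) (obs-sent E (tx s) tx-v)

    receiver-active : ∀ {s u p} → rcv E (tx s) u ≡ just p → Active (suc s) u ≡ true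
    receiver-active {s} {u} eq = trans (active-after-listening {s} {u} (proj₁ (rcv-just E (tx s) eq)))
      (cong (λ r → active (heard (Maybe.map proj₂ r) ∷ hist protocol E s u)) eq)

    -- A dormant node does not transmit, so only a reception can change its state, and the sender
    -- was active.
    woken-by : ∀ {s v} → Active s v ≡ false → Active (suc s) v ≡ true →
               ∃[ u ] E u v ≡ true × Active s u ≡ true
    woken-by {s} {v} dormant woken
      with rcv E (tx s) v in eq
         | trans (sym (active-after-listening {s} {v} (tx-nothing (cong (_∧ schedule n s v) dormant)))) woken
    ... | nothing      | act = contradiction (trans (sym dormant) act) λ ()
    ... | just (u , m) | _   with rcv-sender E (tx s) eq
    ...   | E-uv , tx-u = u , E-uv , tx-active {s} tx-u

    sole-transmitter-retires : ∀ {s y w} → Active s y ≡ true → schedule n s y ≡ true → E y w ≡ true →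
      (Active s w ∧ schedule n s w) ≡ false →
      (∀ z → E z w ≡ true → z ≢ y → (Active s z ∧ schedule n s z) ≡ false) →
      Active (suc s) y ≡ false
    sole-transmitter-retires {s} {y} {w} act sch E-yw w-silent others =
      trans (active-after-sending {s} {y} tx-y) (cong (λ b → active (sent b ∷ hist protocol E s y))
        (sole-transmitter-acked E (tx s) E-yw tx-y (tx-nothing w-silent) λ z E-zw z≢y → tx-nothing (others z E-zw z≢y)))
      where tx-y = tx-just {s} act sch

    -- Listening never makes an active node dormant; only a positive acknowledgement does, and it
    -- comes with a receiver.
    hands-over : ∀ {s v} → Active s v ≡ true → Active (suc s) v ≡ false → ∃[ u ] rcv E (tx s) u ≡ just (v , tt)
    hands-over {s} {v} act retired = go (tx s v) refl
      where
      go : ∀ m → tx s v ≡ m → ∃[ u ] rcv E (tx s) u ≡ just (v , tt)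
      go nothing   tx-v = contradiction
        (trans (sym (trans (active-after-listening {s} {v} tx-v)
          (active-heard (Maybe.map proj₂ (rcv E (tx s) v)) {hist protocol E s v} act))) retired) λ ()
      go (just tt) tx-v = ack-receiver E (tx s) tx-v
        (active-sent _ {hist protocol E s v} act (trans (sym (active-after-sending {s} {v} tx-v)) retired))

    knows-keeps : ∀ {s v r} → knows protocol E s v r ≡ true → knows protocol E (suc s) v r ≡ true
    knows-keeps {s} {v} known with rcv E (tx s) v
    ... | nothing            = known
    ... | just _ rewrite known = refl

    knows-received : ∀ {s u v m r} → rcv E (tx s) u ≡ just (v , m) → knows protocol E s v r ≡ true →
                     knows protocol E (suc s) u r ≡ true
    knows-received {s} {u} {v} {r = r} eq known with rcv E (tx s) u | eq
    ... | just (v , _) | refl rewrite known = ∨-zeroʳ _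

    -- When the current carrier falls dormant, the node that received its message is active and
    -- takes over the role.
    active-carrier : ∀ s r → ∃[ v ] Active s v ≡ true × knows protocol E s v r ≡ true
    active-carrier zero    r = r , refl , dec-true (r ≟ r) refl
    active-carrier (suc s) r with active-carrier s r
    ... | v , act , known with Active (suc s) v in act′
    ...   | true  = v , act′ , knows-keeps {s} known
    ...   | false with hands-over {s} act act′
    ...     | u , received = u , receiver-active {s} received , knows-received {s} received known

    -- Any ancestor-closed set of dormant nodes qualifies, not only the largest one, so that `D` can
    -- be enlarged phase by phase.
    record Retired (s : ℕ) (D : Fin n → Bool) : Set where
      field
        closed  : ∀ {u v} → E u v ≡ true → D v ≡ true → D u ≡ true
        dormant : ∀ {v} → D v ≡ true → Active s v ≡ false

    open Retired

    -- Only an active in-neighbour could wake `v`. The node `v` may lie outside `D`, which covers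
    -- nodes about to retire.
    stays-dormant : ∀ {s D v} → Retired s D → (∀ {u} → E u v ≡ true → D u ≡ true) →
                    Active s v ≡ false → Active (suc s) v ≡ false
    stays-dormant {s} {v = v} ret guarded dorm with Active (suc s) v in act
    ... | false = refl
    ... | true with woken-by {s} dorm act
    ...   | u , E-uv , act-u = contradiction (trans (sym act-u) (dormant ret (guarded E-uv))) λ ()

    retired-suc : ∀ {s D} → Retired s D → Retired (suc s) D
    retired-suc ret = record
      { closed  = closed ret
      ; dormant = λ Dv → stays-dormant ret (λ E-uv → closed ret E-uv Dv) (dormant ret Dv)
      }

    retired-mono : ∀ {s s′ D} → s ≤ s′ → Retired s D → Retired s′ D
    retired-mono {s} {D = D} s≤s′ ret with m≤n⇒∃[o]m+o≡n s≤s′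
    ... | o , refl = go o
      where
      go : ∀ o → Retired (s + o) D
      go zero    = subst (λ s → Retired s D) (sym (+-identityʳ s)) ret
      go (suc o) = subst (λ s → Retired s D) (sym (+-suc s o)) (retired-suc (go o))

    dormant-mono : ∀ {s s′ D v} → s ≤ s′ → Retired s D → (∀ {u} → E u v ≡ true → D u ≡ true) →
                   Active s v ≡ false → Active s′ v ≡ false
    dormant-mono {s} {D = D} {v} s≤s′ ret guarded dorm with m≤n⇒∃[o]m+o≡n s≤s′
    ... | o , refl = go o
      where
      go : ∀ o → Active (s + o) v ≡ false
      go zero    = subst (λ s → Active s v ≡ false) (sym (+-identityʳ s)) dorm
      go (suc o) = subst (λ s → Active s v ≡ false) (sym (+-suc s o))
        (stays-dormant (retired-mono (m≤m+n s o) ret) guarded (go o))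

-- Timing

binary-magnitude : ∀ b .{{_ : NonZero b}} → ∃[ i ] 2 ^ i ≤ b × b < 2 ^ suc i
binary-magnitude 1 = 0 , ≤-refl , ≤-refl
binary-magnitude (suc b@(suc _)) with binary-magnitude b
... | i , 2^i≤b , b<2^1+i with suc b <? 2 ^ suc i
...   | yes 1+b<2^1+i = i , ≤-trans 2^i≤b (n≤1+n b) , 1+b<2^1+i
...   | no  1+b≮2^1+i = suc i , ≮⇒≥ 1+b≮2^1+i ,
        ≤-<-trans b<2^1+i (^-monoʳ-< 2 (s≤s (s≤s z≤n)) (n<1+n (suc i)))

-- Every pair `(i , q)` has one slot in each cycle of `p * L` steps. The slot in the cycle following
-- that of `s` comes before two cycle lengths have passed.
slot-time : ∀ L p i q s .{{_ : NonZero L}} .{{_ : NonZero p}} → i < L → q < p →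
  ∃[ τ ] s ≤ τ × τ < s + 2 * p * L × τ % L ≡ i × τ / L % p ≡ q
slot-time L p i q s i<L q<p = τ , s≤τ , τ<end , τ%L , τ/L%p
  where
  instance pL≢0 = m*n≢0 p L
  a τ : ℕ
  a = suc (s / (p * L))
  τ = i + (q + a * p) * L

  τ%L : τ % L ≡ i
  τ%L = trans ([m+kn]%n≡m%n i (q + a * p) L) (m<n⇒m%n≡m i<L)

  τ/L%p : τ / L % p ≡ q
  τ/L%p = begin-equality
    τ / L % p                             ≡⟨ cong (_% p) (+-distrib-/-∣ʳ i (divides-refl (q + a * p))) ⟩
    (i / L + (q + a * p) * L / L) % p     ≡⟨ cong₂ (λ x y → (x + y) % p) (m<n⇒m/n≡0 i<L) (m*n/n≡m (q + a * p) L) ⟩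
    (q + a * p) % p                       ≡⟨ [m+kn]%n≡m%n q a p ⟩
    q % p                                 ≡⟨ m<n⇒m%n≡m q<p ⟩
    q                                     ∎

  split : ∀ i q a p L → i + (q + a * p) * L ≡ i + q * L + a * (p * L)
  split = solve-∀

  s≤τ : s ≤ τ
  s≤τ = begin
    s                                       ≡⟨ m≡m%n+[m/n]*n s (p * L) ⟩
    s % (p * L) + s / (p * L) * (p * L)     ≤⟨ +-monoˡ-≤ _ (<⇒≤ (m%n<n s (p * L))) ⟩
    a * (p * L)                             ≤⟨ m≤n+m (a * (p * L)) (i + q * L) ⟩
    i + q * L + a * (p * L)                 ≡⟨ split i q a p L ⟨
    τ                                       ∎

  τ<end : τ < s + 2 * p * L
  τ<end = begin-strict
    τ                                         ≡⟨ split i q a p L ⟩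
    i + q * L + a * (p * L)                   <⟨ +-monoˡ-< (a * (p * L)) (+-monoˡ-< (q * L) i<L) ⟩
    suc q * L + a * (p * L)                   ≤⟨ +-monoˡ-≤ (a * (p * L)) (*-monoˡ-≤ L q<p) ⟩
    p * L + a * (p * L)                       ≡⟨ regroup (s / (p * L)) p L ⟩
    s / (p * L) * (p * L) + 2 * p * L         ≤⟨ +-monoˡ-≤ (2 * p * L) (m/n*n≤m s (p * L)) ⟩
    s + 2 * p * L                             ∎
    where
    regroup : ∀ x p L → p * L + suc x * (p * L) ≡ x * (p * L) + 2 * p * L
    regroup = solve-∀

-- The residue modulo `L` picks the family, the quotient its round. The `suc` keeps the period
-- nonzero at the price of one extra round.
interleave : ∀ {n} L (R : ℕ → ℕ) (F : ℕ → ℕ → Transmitters n) .{{_ : NonZero L}} → ℕ → Transmitters n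
interleave L R F s = F (s % L) (s / L % suc (R (s % L)))

interleave-window : ∀ {n} L R (F : ℕ → ℕ → Transmitters n) .{{_ : NonZero L}} {i q} s → i < L → q < R i →
  ∃[ τ ] s ≤ τ × τ < s + 2 * suc (R i) * L × (∀ z → interleave L R F τ z ≡ F i q z)
interleave-window L R F {i} {q} s i<L q<R with slot-time L (suc (R i)) i q s i<L (m<n⇒m<1+n q<R)
... | τ , s≤τ , τ<end , τ%L , τ/L%p = τ , s≤τ , τ<end , λ z →
  trans (cong (λ j → F j (τ / L % suc (R j)) z) τ%L) (cong (λ r → F i r z) τ/L%p)

-- Counting nodes and charging time to them

length-filter-sum : ∀ {A : Set} (p : A → Bool) xs →
  length (filter (λ x → p x Bool.≟ true) xs) ≡ sum (map (ind ∘ p) xs)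
length-filter-sum p [] = refl
length-filter-sum p (x ∷ xs) with p x
... | true  = cong suc (length-filter-sum p xs)
... | false = length-filter-sum p xs

sum-map-+ : ∀ {A : Set} (f g f′ g′ : A → ℕ) xs → (∀ x → f x + g x ≡ f′ x + g′ x) →
  sum (map f xs) + sum (map g xs) ≡ sum (map f′ xs) + sum (map g′ xs)
sum-map-+ f g f′ g′ [] eq = refl
sum-map-+ f g f′ g′ (x ∷ xs) eq = begin-equality
  f x + sum (map f xs) + (g x + sum (map g xs))      ≡⟨ interchange (f x) _ (g x) _ ⟩
  f x + g x + (sum (map f xs) + sum (map g xs))      ≡⟨ cong₂ _+_ (eq x) (sum-map-+ f g f′ g′ xs eq) ⟩
  f′ x + g′ x + (sum (map f′ xs) + sum (map g′ xs))  ≡⟨ interchange (f′ x) (g′ x) _ _ ⟩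
  f′ x + sum (map f′ xs) + (g′ x + sum (map g′ xs))  ∎
  where
  interchange : ∀ a b c d → a + b + (c + d) ≡ a + c + (b + d)
  interchange = solve-∀

-- Amortisation: of `b` nodes at most `y` survive, so at least `h / 2` retire. At `κ` steps each
-- they pay for the window of length `ℓ`.
window-cost : ∀ s ℓ κ {h b y r′ r} → 2 * ℓ ≤ h * κ → h ≤ b → 2 * y ≤ h → r′ + b ≡ r + y →
  s + ℓ + r′ * κ ≤ s + r * κ
window-cost s ℓ κ {h} {b} {y} {r′} {r} 2ℓ≤hκ h≤b 2y≤h r′+b≡r+y = +-cancelʳ-≤ (y * κ) _ _ (begin
  s + ℓ + r′ * κ + y * κ      ≡⟨ regroup₁ s ℓ (r′ * κ) (y * κ) ⟩
  s + r′ * κ + (ℓ + y * κ)    ≤⟨ +-monoʳ-≤ (s + r′ * κ) ℓ+yκ≤bκ ⟩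
  s + r′ * κ + b * κ          ≡⟨ regroup₂ s r′ b κ ⟩
  s + (r′ + b) * κ            ≡⟨ cong (λ x → s + x * κ) r′+b≡r+y ⟩
  s + (r + y) * κ             ≡⟨ regroup₂ s r y κ ⟨
  s + r * κ + y * κ           ∎)
  where
  regroup₁ : ∀ a b c d → a + b + c + d ≡ a + c + (b + d)
  regroup₁ = solve-∀
  regroup₂ : ∀ s a b κ → s + a * κ + b * κ ≡ s + (a + b) * κ
  regroup₂ = solve-∀
  regroup₃ : ∀ ℓ y κ → 2 * (ℓ + y * κ) ≡ 2 * ℓ + 2 * y * κ
  regroup₃ = solve-∀
  regroup₄ : ∀ b κ → b * κ + b * κ ≡ 2 * (b * κ)
  regroup₄ = solve-∀
  ℓ+yκ≤bκ : ℓ + y * κ ≤ b * κ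
  ℓ+yκ≤bκ = *-cancelˡ-≤ 2 (begin
    2 * (ℓ + y * κ)       ≡⟨ regroup₃ ℓ y κ ⟩
    2 * ℓ + 2 * y * κ     ≤⟨ +-mono-≤ (≤-trans 2ℓ≤hκ (*-monoˡ-≤ κ h≤b)) (*-monoˡ-≤ κ (≤-trans 2y≤h h≤b)) ⟩
    b * κ + b * κ         ≡⟨ regroup₄ b κ ⟩
    2 * (b * κ)           ∎)

-- Retirement

module Gathering (schedule : ∀ n → ℕ → Transmitters n) {n : ℕ} (E : Graph n) (acyclic : Acyclic E) where

  open Relay schedule
  open Run E
  open Retired

  nodes : (Fin n → Bool) → List (Fin n)
  nodes p = filter (λ x → p x Bool.≟ true) (allFin n)

  ∈-nodes : ∀ {p x} → p x ≡ true → x ∈ nodes p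
  ∈-nodes {p} {x} = ∈-filter⁺ (λ x → p x Bool.≟ true) (∈-allFin x)

  nodes-∈ : ∀ {p x} → x ∈ nodes p → p x ≡ true
  nodes-∈ {p} = proj₂ ∘ ∈-filter⁻ (λ x → p x Bool.≟ true) {xs = allFin n}

  nodes-unique : ∀ p → Unique (nodes p)
  nodes-unique p = Unique.filter⁺ (λ x → p x Bool.≟ true) (Unique.allFin⁺ n)

  length-nodes-≤ : ∀ p → length (nodes p) ≤ n
  length-nodes-≤ p = ≤-trans (length-filter _ (allFin n)) (≤-reflexive (length-tabulate {n = n} id))

  remaining : (Fin n → Bool) → ℕ
  remaining D = length (nodes (not ∘ D))

  no-loop : ∀ {y w} → E y w ≡ true → w ≢ y
  no-loop E-yw refl = acyclic _ _ E-yw here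

  module Phase {s : ℕ} {D : Fin n → Bool} (ret : Retired s D) (w : Fin n)
               (guarded : ∀ {x u} → E x w ≡ true → E u x ≡ true → D u ≡ true) where

    inU : Fin n → Bool
    inU x = E x w ∧ not (D x)

    U : List (Fin n)
    U = nodes inU

    -- One phase: each round of a selector matching the size of `U` is performed somewhere between
    -- `s` and `s′`.
    module After {s′ h R : ℕ} (s≤s′ : s ≤ s′) (h≤b : h ≤ length U) (b<2h : length U < 2 * h) (sel : Selector n h R)
      (window : ∀ {q} → q < R → ∃[ τ ] s ≤ τ × τ < s′ × (∀ z → schedule n τ z ≡ Selector.family sel q z)) where

      survives : Fin n → Bool
      survives x = inU x ∧ Active s′ x

      Y : List (Fin n)
      Y = nodes survives

      D′ : Fin n → Bool
      D′ x = D x ∨ (E x w ∧ not (Active s′ x))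

      -- By `guarded`, the in-neighbours of every newly added node are already in `D`, so closure is
      -- preserved.
      retired′ : Retired s′ D′
      retired′ = record { closed = closed′ ; dormant = dormant′ }
        where
        ret′ = retired-mono s≤s′ ret

        closed′ : ∀ {u v} → E u v ≡ true → D′ v ≡ true → D′ u ≡ true
        closed′ {u} {v} E-uv D′v with D v in Dv | E v w in E-vw | D′v
        ... | true  | _    | _ rewrite closed ret E-uv Dv = refl
        ... | false | true | _ rewrite guarded E-vw E-uv  = refl

        dormant′ : ∀ {v} → D′ v ≡ true → Active s′ v ≡ false
        dormant′ {v} D′v with D v in Dv
        ... | true = dormant ret′ Dv
        ... | false with E v w | Active s′ v | D′v
        ...   | true | false | _ = refl

      -- Each node of `U` either joins `D′` or survives into `Y`. Written with indicators, the
      -- identity holds node by node.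
      balance : remaining D′ + length U ≡ remaining D + length Y
      balance = begin-equality
        remaining D′ + length U
          ≡⟨ cong₂ _+_ (length-filter-sum (not ∘ D′) (allFin n)) (length-filter-sum inU (allFin n)) ⟩
        sum (map (ind ∘ not ∘ D′) (allFin n)) + sum (map (ind ∘ inU) (allFin n))
          ≡⟨ sum-map-+ (ind ∘ not ∘ D′) (ind ∘ inU) (ind ∘ not ∘ D) (ind ∘ survives) (allFin n)
               (λ x → table (D x) (E x w) (Active s′ x)) ⟩
        sum (map (ind ∘ not ∘ D) (allFin n)) + sum (map (ind ∘ survives) (allFin n))
          ≡⟨ cong₂ _+_ (length-filter-sum (not ∘ D) (allFin n)) (length-filter-sum survives (allFin n)) ⟨
        remaining D + length Y ∎
        where
        table : ∀ d e a → ind (not (d ∨ (e ∧ not a))) + ind (e ∧ not d) ≡ ind (not d) + ind ((e ∧ not d) ∧ a)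
        table true  true  _     = refl
        table true  false _     = refl
        table false false _     = refl
        table false true  true  = refl
        table false true  false = refl

      -- w must compete as well: it hears nothing while it transmits.
      W : List (Fin n)
      W = U ++ replicate (2 * h ∸ length U) w

      w∈W : w ∈ W
      -- The strict bound on `length U` leaves room for at least one copy of `w`.
      w∈W = ∈-++⁺ʳ U (∈-replicate (m<n⇒0<n∸m b<2h))
        where
        ∈-replicate : ∀ {k} → 0 < k → w ∈ replicate k w
        ∈-replicate (s≤s _) = here refl

      -- Otherwise the selector isolates some survivor `y` at a time `τ` in the window. Then `w`
      -- hears `y`, the acknowledgement makes `y` dormant, and its retired in-neighbours cannot wake
      -- it before `s′`.
      few-survivors : length Y < ⌈ h /2⌉
      few-survivors with ⌈ h /2⌉ ≤? length Y
      ... | no  |Y|<    = ≰⇒> |Y|<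
      ... | yes enough with Selector.selects sel {take ⌈ h /2⌉ Y} {W} config-valid
        where
        config-valid : Valid h (take ⌈ h /2⌉ Y , W)
        config-valid = valid
          (Unique.take⁺ ⌈ h /2⌉ (nodes-unique survives))
          (All.take⁺ ⌈ h /2⌉ (All.tabulate λ x∈Y → ∈-++⁺ˡ (∈-nodes (survives⇒inU (nodes-∈ x∈Y)))))
          (trans (length-take ⌈ h /2⌉ Y) (m≤n⇒m⊓n≡m enough))
          (trans (length-++ U) (trans (cong (length U +_) (length-replicate _)) (m+[n∸m]≡n (<⇒≤ b<2h))))
          where
          survives⇒inU : ∀ {x} → survives x ≡ true → inU x ≡ true
          survives⇒inU {x} eq with inU x
          ... | true = refl
      ...   | q , q<R , y , y∈take , y-selected , others-silent
        with window q<R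
      ...     | τ , s≤τ , τ<s′ , schedule-τ = contradiction (trans (sym y-active) y-dormant) λ ()
        where
        y-survives : survives y ≡ true
        y-survives = nodes-∈ (∈-take⁻ y∈take)
          where
          ∈-take⁻ : ∀ {m xs} → y ∈ take m xs → y ∈ xs
          ∈-take⁻ {suc m} {x ∷ xs} (here eq)   = here eq
          ∈-take⁻ {suc m} {x ∷ xs} (there y∈) = there (∈-take⁻ {m} y∈)

        y-active : Active s′ y ≡ true
        y-active with inU y | y-survives
        ... | true | act = act

        E-yw : E y w ≡ true
        E-yw with E y w | y-survives
        ... | true | _ = refl

        ret-τ : Retired τ D
        ret-τ = retired-mono s≤τ ret

        -- Had `y` been dormant at `τ`, it would still be dormant at `s′`.
        y-active-τ : Active τ y ≡ true
        y-active-τ with Active τ y in eq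
        ... | true  = refl
        ... | false = trans (sym (dormant-mono (<⇒≤ τ<s′) ret-τ (guarded E-yw) eq)) y-active

        silent : ∀ {z} → z ∈ W → z ≢ y → (Active τ z ∧ schedule n τ z) ≡ false
        silent {z} z∈W z≢y = trans (cong (Active τ z ∧_) (trans (schedule-τ z) (others-silent z∈W z≢y))) (∧-zeroʳ _)

        -- In-neighbours of `w` in `D` are silent by dormancy, all others by the selector.
        in-neighbours-silent : ∀ z → E z w ≡ true → z ≢ y → (Active τ z ∧ schedule n τ z) ≡ false
        in-neighbours-silent z E-zw z≢y with D z in Dz
        ... | true  = cong (_∧ schedule n τ z) (dormant ret-τ Dz)
        ... | false = silent (∈-++⁺ˡ (∈-nodes z∈U)) z≢y
          where
          z∈U : inU z ≡ true
          z∈U rewrite E-zw | Dz = refl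

        y-dormant : Active s′ y ≡ false
        y-dormant = dormant-mono τ<s′ (retired-suc ret-τ) (guarded E-yw)
          (sole-transmitter-retires {τ} y-active-τ (trans (schedule-τ y) y-selected) E-yw
            (silent w∈W (no-loop E-yw)) in-neighbours-silent)

      2|Y|<h : 2 * length Y < h
      2|Y|<h = +-cancelˡ-< 1 _ _ (begin-strict
        1 + 2 * length Y                  <⟨ ≤-reflexive (doubling (length Y)) ⟩
        suc (length Y) + suc (length Y)   ≤⟨ +-mono-≤ few-survivors few-survivors ⟩
        -- Here `⌈ h /2⌉` is `⌊ suc h /2⌋` by definition, so the two halves of `suc h` recombine.
        ⌈ h /2⌉ + ⌈ h /2⌉                 ≤⟨ +-monoˡ-≤ ⌈ h /2⌉ (⌈n/2⌉-mono (n≤1+n h)) ⟩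
        ⌈ suc h /2⌉ + ⌊ suc h /2⌋         ≡⟨ trans (+-comm ⌈ suc h /2⌉ _) (⌊n/2⌋+⌈n/2⌉≡n (suc h)) ⟩
        1 + h                             ∎)
        where
        doubling : ∀ y → suc (1 + 2 * y) ≡ suc y + suc y
        doubling = solve-∀

      progress : remaining D′ < remaining D
      progress = +-cancelʳ-< (length Y) _ _ (begin-strict
        remaining D′ + length Y   <⟨ +-monoʳ-< (remaining D′) (≤-<-trans (m≤m+n (length Y) _) (<-≤-trans 2|Y|<h h≤b)) ⟩
        remaining D′ + length U   ≡⟨ balance ⟩
        remaining D + length Y    ∎)

  -- Choice of the receiver and iteration of phases

  pending? : ∀ (D : Fin n → Bool) → Dec (∃[ w ] ∃[ x ] E x w ≡ true × D x ≡ false)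
  pending? D = any? λ w → any? λ x → E x w Bool.≟ true ×-dec D x Bool.≟ false

  -- Paths with at least one edge: acyclicity makes this relation irreflexive, and a strict order on
  -- a finite set is well-founded.
  _⊏_ : Fin n → Fin n → Set
  x ⊏ y = ∃[ w ] E x w ≡ true × Reach E w y

  reach-trans : ∀ {x y z} → Reach E x y → Reach E y z → Reach E x z
  reach-trans here          y⇝z = y⇝z
  reach-trans (step e x⇝y)  y⇝z = step e (reach-trans x⇝y y⇝z)

  ⊏-isStrictPartialOrder : IsStrictPartialOrder _≡_ _⊏_
  ⊏-isStrictPartialOrder = record
    { isEquivalence = isEquivalence
    ; irrefl        = λ { refl (w , E-xw , w⇝x) → acyclic _ w E-xw w⇝x }
    ; trans         = λ { (w , E-xw , w⇝y) (w′ , E-yw′ , w′⇝z) → w , E-xw , reach-trans w⇝y (step E-yw′ w′⇝z) }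
    ; <-resp-≈      = resp₂ _⊏_
    }

  -- If some in-neighbour `x` of `w` has a non-retired in-neighbour as well, the search moves back
  -- to `x`, which precedes `w`.
  first-receiver : ∀ (D : Fin n → Bool) w → Acc _⊏_ w → (∃[ x ] E x w ≡ true × D x ≡ false) →
    ∃[ w ] (∃[ x ] E x w ≡ true × D x ≡ false) × (∀ {x u} → E x w ≡ true → E u x ≡ true → D u ≡ true)
  first-receiver D w (acc rec) pending
    with any? (λ x → E x w Bool.≟ true ×-dec any? λ u → E u x Bool.≟ true ×-dec D u Bool.≟ false)
  ... | yes (x , E-xw , pending′) = first-receiver D x (rec (w , E-xw , here)) pending′
  ... | no none = w , pending , λ {x} {u} E-xw E-ux → ¬-not {D u} {false} λ Du → none (x , E-xw , u , E-ux , Du)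

  -- Here `κ` is the time charged to each retired node, and `ℓ i` the length of a window in which
  -- all rounds of selector `i` occur.
  module _ (κ : ℕ) (R ℓ : ℕ → ℕ) (sel : ∀ i → Selector n (2 ^ i) (R i)) (ℓ-bound : ∀ i → 2 * ℓ i ≤ 2 ^ i * κ)
    (window : ∀ {i q} s → 2 ^ i ≤ n → q < R i →
      ∃[ τ ] s ≤ τ × τ < s + ℓ i × (∀ z → schedule n τ z ≡ Selector.family (sel i) q z)) where

    -- Phases repeat until every node with an outgoing edge is retired. Each one strictly lowers
    -- `remaining D`, which the fuel bounds.
    retire-all : ∀ fuel s D → remaining D ≤ fuel → Retired s D →
      ∃[ s′ ] Σ (Fin n → Bool) λ D′ → Retired s′ D′ × (∀ {x w} → E x w ≡ true → D′ x ≡ true) × s′ ≤ s + remaining D * κ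
    retire-all fuel s D r≤fuel ret with pending? D
    ... | no done = s , D , ret , (λ {x} {w} E-xw → ¬-not {D x} {false} λ Dx → done (w , x , E-xw , Dx)) , m≤m+n s _
    ... | yes (w , pending) with first-receiver D w (spo-wellFounded ⊏-isStrictPartialOrder w) pending
    ...   | w , (x , E-xw , Dx) , guarded = next fuel r≤fuel
      where
      open Phase ret w guarded

      U-nonempty : NonZero (length U)
      U-nonempty = occupied (∈-nodes x∈U)
        where
        x∈U : inU x ≡ true
        x∈U rewrite E-xw | Dx = refl
        occupied : ∀ {xs : List (Fin n)} → x ∈ xs → NonZero (length xs)
        occupied (here _)  = _
        occupied (there _) = _

      magnitude = binary-magnitude (length U) {{U-nonempty}}
      i = proj₁ magnitude
      h≤b = proj₁ (proj₂ magnitude)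
      b<2h = proj₂ (proj₂ magnitude)
      window′ : ∀ {q} → q < R i → ∃[ τ ] s ≤ τ × τ < s + ℓ i × (∀ z → schedule n τ z ≡ Selector.family (sel i) q z)
      window′ = window {i} s (≤-trans h≤b (length-nodes-≤ inU))
      module Phase′ = After (m≤m+n s (ℓ i)) h≤b b<2h (sel i) window′

      next : ∀ fuel → remaining D ≤ fuel →
        ∃[ s′ ] Σ (Fin n → Bool) λ D′ → Retired s′ D′ × (∀ {x w} → E x w ≡ true → D′ x ≡ true) × s′ ≤ s + remaining D * κ
      next zero       r≤0   = contradiction (≤-trans Phase′.progress r≤0) λ ()
      next (suc fuel) r≤1+f with retire-all fuel (s + ℓ i) Phase′.D′ (≤-pred (≤-trans Phase′.progress r≤1+f)) Phase′.retired′
      ... | s′ , D″ , ret″ , all-retired , s′≤ = s′ , D″ , ret″ , all-retired ,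
        ≤-trans s′≤ (window-cost s (ℓ i) κ {y = length Phase′.Y} {r = remaining D} (ℓ-bound i) h≤b (<⇒≤ Phase′.2|Y|<h) Phase′.balance)

    -- At time `T` an active carrier of the rumor has no outgoing edge. As it reaches `t`, it is
    -- `t`.
    gathered : ∀ t → (∀ v → Reach E v t) → ∀ T → n * κ ≤ T → Gathered protocol E t T
    gathered t reach T nκ≤T r
      with s′ , D , ret , all-retired , s′≤ ← retire-all n 0 (λ _ → false) (length-nodes-≤ _)
        (record { closed = λ _ () ; dormant = λ () })
      with active-carrier T r
    ... | v , act , known with reach v
    ...   | here = known
    ...   | step E-vw _ = contradiction
      (trans (sym act) (dormant (retired-mono s′≤T ret) (all-retired E-vw))) λ ()
      where
      s′≤T : s′ ≤ T
      s′≤T = ≤-trans s′≤ (≤-trans (*-monoˡ-≤ κ (length-nodes-≤ _)) nκ≤T)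

-- Parameters and running time

levels : ℕ → ℕ
levels n = suc ⌊log₂ n ⌋

exponent<levels : ∀ {n i} → 2 ^ i ≤ n → i < levels n
exponent<levels {n} {i} 2^i≤n = s≤s (subst (_≤ ⌊log₂ n ⌋) (⌊log₂[2^n]⌋≡n i) (⌊log₂⌋-mono-≤ 2^i≤n))

n≤2^levels : ∀ n → n ≤ 2 ^ levels n
n≤2^levels zero = z≤n
n≤2^levels n@(suc _) with binary-magnitude n
... | i , 2^i≤n , n<2^1+i = ≤-trans (<⇒≤ n<2^1+i) (^-monoʳ-≤ 2 (exponent<levels {n} {i} 2^i≤n))

selectorSize : ℕ → ℕ → ℕ
selectorSize n i = 11 * (levels n * (4 * 2 ^ i))

selectorAt : ∀ n i → Selector n (2 ^ i) (selectorSize n i)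
selectorAt n i = selector n (2 ^ i) (levels n) {{m^n≢0 2 i}} (n≤2^levels n)

schedule : ∀ n → ℕ → Transmitters n
schedule n = interleave (levels n) (selectorSize n) (λ i → Selector.family (selectorAt n i))

-- The constant is `180 = 176 + 4`: the selector contributes `2 * 2 * 11 * 4`, the extra round of
-- each period the rest.
window-length : ∀ h L .{{_ : NonZero h}} .{{_ : NonZero L}} →
  2 * (2 * suc (11 * (L * (4 * h))) * L) ≤ h * (180 * (L * L))
window-length h L = begin
  2 * (2 * suc (11 * (L * (4 * h))) * L)        ≡⟨ expand h L ⟩
  4 * (1 * L) + 176 * (h * L * L)               ≤⟨ +-monoˡ-≤ _ (*-monoʳ-≤ 4 (*-monoˡ-≤ L (>-nonZero⁻¹ (h * L) {{m*n≢0 h L}}))) ⟩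
  4 * (h * L * L) + 176 * (h * L * L)           ≡⟨ collect h L ⟩
  h * (180 * (L * L))                           ∎
  where
  expand : ∀ h L → 2 * (2 * (1 + 11 * (L * (4 * h))) * L) ≡ 4 * (1 * L) + 176 * (h * L * L)
  expand = solve-∀
  collect : ∀ h L → 4 * (h * L * L) + 176 * (h * L * L) ≡ h * (180 * (L * L))
  collect = solve-∀

-- Replacing `suc l` by `l + l` costs a factor of four, whence `720 = 4 * 180`.
running-time : ∀ n l → 1 ≤ l → n * (180 * (suc l * suc l)) ≤ 720 * n * l ^ 2
running-time n l 1≤l = begin
  n * (180 * (suc l * suc l))          ≤⟨ *-monoʳ-≤ n (*-monoʳ-≤ 180 (*-mono-≤ 1+l≤l+l 1+l≤l+l)) ⟩
  n * (180 * ((l + l) * (l + l)))      ≡⟨ collect 180 n l ⟩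
  720 * n * l ^ 2                      ∎
  where
  1+l≤l+l : suc l ≤ l + l
  1+l≤l+l = +-monoˡ-≤ l 1≤l
  collect : ∀ d n l → n * (d * ((l + l) * (l + l))) ≡ 4 * d * n * (l * (l * 1))
  collect = solve-∀

theorem3 : Σ Protocol λ P → ∃[ c ] ∃[ N ] ∀ (n : ℕ) → N ≤ n →
    ∀ (E : Graph n) (t : Fin n) → Acyclic E → (∀ (v : Fin n) → Reach E v t) →
    Gathered P E t (c * n * (⌊log₂ n ⌋ ^ 2))
-- The threshold 2 makes the logarithm at least one, as `running-time` demands.
theorem3 = Relay.protocol schedule , 720 , 2 , λ n 2≤n E t acyclic reach →
  Gathering.gathered schedule E acyclic (180 * (levels n * levels n))
    (selectorSize n) (λ i → 2 * suc (selectorSize n i) * levels n)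
    (selectorAt n) (λ i → window-length (2 ^ i) (levels n) {{m^n≢0 2 i}})
    (λ {i} s 2^i≤n → interleave-window (levels n) (selectorSize n)
      (λ i → Selector.family (selectorAt n i)) {i} s (exponent<levels 2^i≤n))
    t reach (720 * n * (⌊log₂ n ⌋ ^ 2)) (running-time n ⌊log₂ n ⌋ (⌊log₂⌋-mono-≤ 2≤n))
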